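{- Let $I\subseteq N$ with $|I|=k$ and let $F\in\mathcal F_{q-k+1}$. Then $$\widehat\chi_F(I)\in\{0,+1,-1\},$$ and $$\widehat\chi_F(I)\neq0\quad\Longleftrightarrow\quad N\setminus I\text{ is a spanning tree of }H_F.$$ Moreover, $$\widehat\chi_F(I)=(-1)^{k(q+1)}\,\varepsilon_N(I)\,\chi_F(N\setminus I).$$
   Context: Network. $G=(V,E)$ is a finite connected simple undirected graph. A spanning forest $F$ of $G$ is an acyclic subgraph with vertex set $V$ (isolated vertices allowed); $\mathcal F_m$ is the set of spanning forests with exactly $m$ connected components. Matrix conventions. $A[S,T]$ is the submatrix with rows $S$ and columns $T$ in inherited order; $A[:,T]$ keeps all rows; empty determinants equal $1$. Superports. The boundary $M\subseteq V$ is nonempty and partitioned into nonempty superports $M=A_1\sqcup\cdots\sqcup A_p$. Choose a root $r_a\in A_a$ for each $a$; $R=\{r_1,\dots,r_p\}$, $N=M\setminus R$, $q=|N|$, $N=(x_1,\dots,x_q)$ in a fixed order; $r(x)$ is the root of the superport containing $x$. Fix a ground root $g\in R$. In $\mathbb R^{V\setminus\{g\}}$ with standard basis $(e_v)$ and the convention $e_g=0$, let $D$ be the matrix whose columns are $d_x=e_x-e_{r(x)}$, $x\in N$, in the fixed order. Quotient port graph. For a spanning forest $F$ with $s\ge1$ components, let $C_0(F)$ be the component containing $g$ and order the others as $C_1(F),\dots,C_{s-1}(F)$. The quotient port multigraph $H_F$ has the components of $F$ as vertices, and each $x\in N$ gives a directed edge from the component containing $r(x)$ to the component containing $x$ (a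 loop if these coincide); subsets of $N$ are thereby regarded as edge sets of $H_F$. Let $Q_F$ be the $(s-1)\times(|V|-1)$ matrix with columns indexed by $V\setminus\{g\}$ and $(Q_F)_{a,v}=1$ if $v\in C_a(F)$, $0$ otherwise ($1\le a\le s-1$), and $B_F=Q_FD$. For $S\subseteq N$ with $|S|=s-1$, $\chi_F(S)=\det B_F[:,S]$, with $\chi_F(\varnothing)=1$ when $s=1$. Completed determinant. For $I\subseteq N$, $|I|=k$, let $E_I$ be the $q\times k$ matrix whose columns are the standard basis vectors of $\mathbb R^N$ indexed by $I$, in inherited order. For $F\in\mathcal F_{q-k+1}$, $\widehat\chi_F(I)=\det\begin{pmatrix}B_F \\ E_I^T\end{pmatrix}$, a $q\times q$ determinant. Orientation sign. For an ordered finite set $U$ and $S=\{s_1<\cdots<s_r\}\subseteq U$, $\varepsilon_U(S)=(-1)^{\sum_{a=1}^r\operatorname{pos}_U(s_a)-r(r+1)/2}$, where $\operatorname{pos}_U$ denotes one-based position in $U$. -}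

module Defs where

open import Algebra.Properties.Semiring.Sum using (sum)
open import Data.Bool.Base using (if_then_else_)
open import Data.Fin.Base using (Fin; zero; suc; toℕ; cast; punchIn)
open import Data.Fin.Properties using (_≟_)
open import Data.Fin.Subset using (Subset; inside; outside; _∈_; ∣_∣; Nonempty)
open import Data.Integer.Base using (ℤ; 0ℤ; 1ℤ; -1ℤ; _*_; _-_; _^_)
import Data.Integer.Properties as ℤ
open import Data.List.Base using (List; []; _∷_)
open import Data.List.Relation.Unary.Unique.Propositional using (Unique)
open import Data.Nat.Base as ℕ using (ℕ; zero; suc; _+_; _∸_)
open import Data.Nat.DivMod using (_/_)
import Data.Nat.Properties as ℕ
open import Data.Product.Base using (Σ-syntax; ∃-syntax; _×_; _,_; proj₁)
open import Data.Sum.Base using (_⊎_)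
open import Data.Vec.Base using ([]; _∷_)
open import Data.Vec.Functional using (Vector; transpose; _++_)
open import Function.Bundles using (_⇔_; Equivalence)
open import Relation.Binary.PropositionalEquality using (_≡_; _≢_; sym)
open import Relation.Nullary using (¬_; does)

------------------------------------------------------------------------
-- Matrices and determinants.  All matrices that occur have integer entries.

Matrix : ℕ → ℕ → Set
Matrix m n = Vector (Vector ℤ n) m

δ : ∀ {n} → Fin n → Fin n → ℤ
δ i j = if does (i ≟ j) then 1ℤ else 0ℤ

infixl 7 _·_
_·_ : ∀ {l m n} → Matrix l m → Matrix m n → Matrix l n
(A · B) i j = sum ℤ.+-*-semiring λ k → A i k * B k j

-- Cofactor expansion along the first row.
det : ∀ {n} → Matrix n n → ℤ
det {zero}  A = 1ℤ
det {suc n} A = sum ℤ.+-*-semiring λ j →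
  -1ℤ ^ toℕ j * A zero j * det (λ i l → A (suc i) (punchIn j l))

-- The elements of a subset, in increasing order.
enum : ∀ {n} (S : Subset n) → Fin ∣ S ∣ → Fin n
enum (inside  ∷ S) zero    = zero
enum (inside  ∷ S) (suc i) = suc (enum S i)
enum (outside ∷ S) i       = suc (enum S i)

_[:,_] : ∀ {m n} → Matrix m n → (T : Subset n) → Matrix m ∣ T ∣
(A [:, T ]) i j = A i (enum T j)

-- The columns of E I are the standard basis vectors indexed by I.
E : ∀ {q} (I : Subset q) → Matrix q ∣ I ∣
E I i a = δ i (enum I a)

-- The ambient ordered set is Fin q, in which i has one-based position
-- suc (toℕ i).  The r positions are distinct, so their sum is at least
-- r(r+1)/2 and the subtraction never truncates.
ε : ∀ {q} → Subset q → ℤ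
ε S = -1ℤ ^ (sum ℕ.+-*-semiring (λ a → suc (toℕ (enum S a)))
             ∸ ∣ S ∣ ℕ.* suc ∣ S ∣ / 2)

------------------------------------------------------------------------
-- Graphs with v vertices and e edges.  Loops and parallel edges are
-- allowed, and each edge carries an orientation, which walks ignore.  A
-- spanning subgraph is given by its set of edges.

record Graph (v e : ℕ) : Set where
  field
    src tgt : Fin e → Fin v

  Joins : Fin e → Fin v → Fin v → Set
  Joins i u w = (src i ≡ u × tgt i ≡ w) ⊎ (src i ≡ w × tgt i ≡ u)

  record Simple : Set where
    field
      loopless    : ∀ i → src i ≢ tgt i
      no-parallel : ∀ i j → Joins i (src j) (tgt j) → i ≡ j

  data Walk (S : Subset e) : Fin v → Fin v → Set where
    []   : ∀ {u} → Walk S u u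
    step : ∀ {u w z} (i : Fin e) → i ∈ S → Joins i u w → Walk S w z → Walk S u z

  edges : ∀ {S u w} → Walk S u w → List (Fin e)
  edges []             = []
  edges (step i _ _ p) = i ∷ edges p

  -- The vertices visited, except the final one.
  vertices : ∀ {S u w} → Walk S u w → List (Fin v)
  vertices []                 = []
  vertices (step {u} _ _ _ p) = u ∷ vertices p

  Connected : Subset e → Set
  Connected S = ∀ u w → Walk S u w

  -- Distinctness of the edges excludes going back and forth along one
  -- edge; loops and pairs of parallel edges do count as cycles.
  IsCycle : ∀ {S u} → Walk S u u → Set
  IsCycle p = edges p ≢ [] × Unique (edges p) × Unique (vertices p)

  Acyclic : Subset e → Set
  Acyclic S = ∀ {u} (p : Walk S u u) → ¬ IsCycle p

  IsSpanningTree : Subset e → Set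
  IsSpanningTree S = Connected S × Acyclic S

  -- C numbers the connected components of S by Fin c: the component with
  -- number a is the (nonempty) set of vertices u such that C u ≡ a.
  record IsComponentNumbering {c} (S : Subset e) (C : Fin v → Fin c) : Set where
    field
      surjective : ∀ a → ∃[ u ] C u ≡ a
      separates  : ∀ u w → C u ≡ C w ⇔ Walk S u w

  -- S is (the edge set of) a spanning forest with exactly c components.
  _∈𝓕_ : Subset e → ℕ → Set
  S ∈𝓕 c = Acyclic S × Σ[ C ∈ (Fin v → Fin c) ] IsComponentNumbering S C

------------------------------------------------------------------------
-- Superports A of a boundary M inside the vertex set Fin v, with chosen
-- roots, a ground root g and an ordering x of the non-root ports N = M ∖ R.
-- Subsets of N are represented by subsets of Fin q via x.

record Superports (v p q : ℕ) : Set where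
  field
    M          : Subset v
    A          : Fin p → Subset v
    M-nonempty : Nonempty M
    A-nonempty : ∀ a → Nonempty (A a)
    A-cover    : ∀ u → u ∈ M ⇔ (∃[ a ] u ∈ A a)
    A-disjoint : ∀ {u a b} → u ∈ A a → u ∈ A b → a ≡ b
    root       : Fin p → Fin v
    root∈A     : ∀ a → root a ∈ A a

  InR : Fin v → Set
  InR u = ∃[ a ] root a ≡ u

  InN : Fin v → Set
  InN u = u ∈ M × ¬ InR u

  field
    g           : Fin v
    g∈R         : InR g
    x           : Fin q → Fin v
    x-injective : ∀ {i j} → x i ≡ x j → i ≡ j
    x-image     : ∀ u → InN u ⇔ (∃[ j ] x j ≡ u)

  port : ∀ {u} → u ∈ M → Fin p
  port {u} u∈M = proj₁ (Equivalence.to (A-cover u) u∈M)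

  x∈M : ∀ j → x j ∈ M
  x∈M j = proj₁ (Equivalence.from (x-image (x j)) (j , _≡_.refl))

  -- The root r(x) of the superport containing x.
  r : Fin q → Fin v
  r j = root (port (x∈M j))

------------------------------------------------------------------------
-- The vertex set is Fin (suc n), and V ∖ {g} is Fin n via punchIn g.  The
-- components of a forest with t + 1 components are given by a numbering C
-- under which g has number zero.

module Quotient {n p q} (P : Superports (suc n) p q) where
  open Superports P

  -- No vertex of V ∖ {g} equals g, so e g = 0.
  e : Fin (suc n) → Vector ℤ n
  e w u = δ (punchIn g u) w

  D : Matrix n q
  D u j = e (x j) u - e (r j) u

  module _ {t} (C : Fin (suc n) → Fin (suc t)) where

    H : Graph (suc t) q
    H = record { src = λ j → C (r j) ; tgt = λ j → C (x j) }

    Q : Matrix t n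
    Q a u = δ (C (punchIn g u)) (suc a)

    B : Matrix t q
    B = Q · D

    χ : (S : Subset q) → ∣ S ∣ ≡ t → ℤ
    χ S eq = det λ i j → (B [:, S ]) i (cast (sym eq) j)

    χ̂ : (I : Subset q) → t + ∣ I ∣ ≡ q → ℤ
    χ̂ I eq = det λ i → (B ++ transpose (E I)) (cast (sym eq) i)

{-# OPTIONS --safe #-}

-- Since e g = 0 and C g = 0, the matrix B = Q D is the incidence matrix of H
-- with the row of vertex 0 removed.  Cofactor expansion along the rows of B
-- only meets columns outside I, because deleting a column of I leaves a zero
-- row in the lower block; this gives the formula for χ̂ up to counting
-- inversions, and reduces the rest to the minor d of B on the columns of ∁ I.
-- If ∁ I is connected, the walks from 0 to the other vertices are the columns
-- of an integral right inverse of that minor, so d = ±1.  Otherwise the rows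
-- belonging to a component that avoids 0 sum to zero, so d = 0.  Finally, a
-- cycle in ∁ I is a linear dependency among the columns with some coefficient
-- ±1, so d ≠ 0 forces acyclicity.
module Submission where

open import Defs
import Algebra.Properties.Semiring.Sum
open import Data.Fin.Base using (Fin; zero; suc; toℕ; punchIn; cast; splitAt; _↑ʳ_)
open import Data.Fin.Properties using (_≟_; any?; cast-involutive; cast-is-id;
  punchInᵢ≢i; splitAt-↑ʳ; suc-injective; toℕ-cast; toℕ-injective)
open import Data.Fin.Subset using (Subset; ∣_∣; ∁; ⊤; inside; outside; _∈_; _∉_)
open import Data.Fin.Subset.Properties using (∣p∣≤n; ∣∁p∣≡n∸∣p∣; x∈p⇒x∉∁p)
open import Data.Integer.Base as ℤ using (ℤ; 0ℤ; 1ℤ; -1ℤ; +[1+_]; -[1+_]; _+_; _*_; -_; _-_; _^_)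
import Data.Integer.Properties as ℤ
open import Data.Integer.Tactic.RingSolver using (solve-∀)
open import Data.List.Relation.Unary.All using (All; _∷_)
open import Data.List.Relation.Unary.AllPairs using (_∷_)
open import Data.Nat.Base as ℕ using (ℕ; zero; suc; _∸_)
open import Data.Nat.DivMod using (_/_; m*n/n≡m)
open import Data.Nat.Properties as ℕ using (m∸n+n≡m)
import Data.Nat.Tactic.RingSolver as ℕ-RingSolver
open import Data.Product.Base using (∃-syntax; _×_; _,_)
open import Data.Sum.Base as Sum using (_⊎_; inj₁; inj₂; [_,_]′)
open import Data.Vec.Base using ([]; _∷_; here; there)
open import Data.Vec.Functional using (Vector; tail; transpose; _++_) renaming (_∷_ to _◂_)
open import Function.Base using (_∘_; id)
open import Function.Bundles using (_⇔_; mk⇔; Equivalence)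
open import Relation.Nullary using (yes; no; ¬?; contradiction)
open import Relation.Nullary.Decidable using (decidable-stable)
open import Relation.Binary.PropositionalEquality using (_≡_; _≢_; _≗_; refl; sym; trans; cong; cong₂; subst;
  module ≡-Reasoning)

open Algebra.Properties.Semiring.Sum ℤ.+-*-semiring
open ≡-Reasoning

-- Determinants

infix 4 _≐_
_≐_ : ∀ {m n} → Matrix m n → Matrix m n → Set
A ≐ B = ∀ i j → A i j ≡ B i j

minor : ∀ {n} → Matrix (suc n) (suc n) → Fin (suc n) → Fin (suc n) → Matrix n n
minor A i j k l = A (punchIn i k) (punchIn j l)

det-cong : ∀ {n} {A B : Matrix n n} → A ≐ B → det A ≡ det B
det-cong {zero}  A≐B = refl
det-cong {suc n} A≐B = sum-cong-≗ λ j →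
  cong₂ _*_ (cong (-1ℤ ^ toℕ j *_) (A≐B zero j)) (det-cong λ k l → A≐B (suc k) (punchIn j l))

sum-zero : ∀ {n} {f : Vector ℤ n} → (∀ i → f i ≡ 0ℤ) → sum f ≡ 0ℤ
sum-zero {n} f≡0 = trans (sum-cong-≗ f≡0) (sum-replicate-zero n)

-- By induction. The corner term is common to both expansions. In every other term of the row
-- expansion the minor is expanded along its first column, and interchanging the two sums collects
-- the row expansions of the minors `minor A (suc i) zero`.
det-expand-column : ∀ {n} (A : Matrix (suc n) (suc n)) →
  det A ≡ sum λ i → -1ℤ ^ toℕ i * A i zero * det (minor A i zero)
det-expand-column {zero}  A = refl
det-expand-column {suc n} A = cong (-1ℤ ^ 0 * A zero zero * det (minor A zero zero) +_) (begin
  sum (λ j → c j * det (minor A zero (suc j)))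
    ≡⟨ sum-cong-≗ (λ j → cong (c j *_) (det-expand-column (minor A zero (suc j)))) ⟩
  sum (λ j → c j * sum (λ i → s i * b i * d i j))
    ≡⟨ sum-cong-≗ (λ j → *-distribˡ-sum (c j) (λ i → s i * b i * d i j)) ⟩
  sum (λ j → sum (λ i → c j * (s i * b i * d i j)))
    ≡⟨ ∑-comm (λ j i → c j * (s i * b i * d i j)) ⟩
  sum (λ i → sum (λ j → c j * (s i * b i * d i j)))
    ≡⟨ sum-cong-≗ (λ i → sum-cong-≗ (λ j → exchange (s j) (a j) (s i) (b i) (d i j))) ⟩
  sum (λ i → sum (λ j → -1ℤ * s i * b i * (s j * a j * d i j)))
    ≡⟨ sum-cong-≗ (λ i → *-distribˡ-sum (-1ℤ * s i * b i) (λ j → s j * a j * d i j)) ⟨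
  sum (λ i → -1ℤ * s i * b i * det (minor A (suc i) zero)) ∎)
  where
  s : Vector ℤ (suc n)
  s i = -1ℤ ^ toℕ i

  a b c : Vector ℤ (suc n)
  a j = A zero (suc j)
  b i = A (suc i) zero
  c j = -1ℤ * s j * a j

  d : Matrix (suc n) (suc n)
  d i j = det (λ k l → A (suc (punchIn i k)) (suc (punchIn j l)))

  exchange : ∀ s a t b d → -1ℤ * s * a * (t * b * d) ≡ -1ℤ * t * b * (s * a * d)
  exchange = solve-∀

det-transpose : ∀ {n} (A : Matrix n n) → det (transpose A) ≡ det A
det-transpose {zero}  A = refl
det-transpose {suc n} A = trans
  (sum-cong-≗ λ j → cong (-1ℤ ^ toℕ j * A j zero *_) (det-transpose (minor A j zero)))
  (sym (det-expand-column A))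

-- Alternating forms in the rows of a matrix

Form : ℕ → ℕ → Set
Form n m = Matrix n m → ℤ

-- Linearity is stated for three matrices that agree off row `i`, which avoids replacing rows, and
-- `f-cong` stands in for function extensionality. Only adjacent equal rows are mentioned, because
-- that is what an induction on minors can check directly.
record Alternating {n m} (f : Form n m) : Set where
  field
    f-cong   : ∀ {X Y} → X ≐ Y → f X ≡ f Y
    linear   : ∀ i a b {X Y Z} →
               (∀ k → k ≢ i → ∀ u → X k u ≡ Z k u) →
               (∀ k → k ≢ i → ∀ u → Y k u ≡ Z k u) →
               (∀ u → Z i u ≡ a * X i u + b * Y i u) →
               f Z ≡ a * f X + b * f Y
    adjacent : ∀ {i j X} → toℕ j ≡ suc (toℕ i) → (∀ u → X i u ≡ X j u) → f X ≡ 0ℤ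

open Alternating

◂-cong : ∀ {n m} {x y : Vector ℤ m} {X Y : Matrix n m} → x ≗ y → X ≐ Y → (x ◂ X) ≐ (y ◂ Y)
◂-cong x≗y X≐Y zero    = x≗y
◂-cong x≗y X≐Y (suc i) = X≐Y i

module _ {n m} {f : Form (suc n) m} (alt : Alternating f) where

  alternating-◂ : ∀ x → Alternating (λ X → f (x ◂ X))
  alternating-◂ x .f-cong X≐Y = f-cong alt (◂-cong (λ _ → refl) X≐Y)
  alternating-◂ x .linear i a b X~Z Y~Z = linear alt (suc i) a b
    (λ { zero _ _ → refl ; (suc k) k≢i → X~Z k (k≢i ∘ cong suc) })
    (λ { zero _ _ → refl ; (suc k) k≢i → Y~Z k (k≢i ∘ cong suc) })
  alternating-◂ x .adjacent j≡1+i = adjacent alt (cong suc j≡1+i)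

  linear-head : ∀ a b {x y z X} → (∀ u → z u ≡ a * x u + b * y u) →
    f (z ◂ X) ≡ a * f (x ◂ X) + b * f (y ◂ X)
  linear-head a b = linear alt zero a b
    (λ { zero 0≢0 → contradiction refl 0≢0 ; (suc k) _ _ → refl })
    (λ { zero 0≢0 → contradiction refl 0≢0 ; (suc k) _ _ → refl })

  linear-head-sum : ∀ {k} (c : Vector ℤ k) (x : Matrix k m) {z X} →
    (∀ u → z u ≡ sum λ j → c j * x j u) →
    f (z ◂ X) ≡ sum λ j → c j * f (x j ◂ X)
  linear-head-sum {zero}  c x {z} {X} z≗ =
    -- The empty combination is the zero row, here read as `0ℤ` times `z` plus `0ℤ` times `z`; the
    -- resulting value computes to zero.
    linear-head 0ℤ 0ℤ {z} {z} z≗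
  linear-head-sum {suc k} c x {z} {X} z≗ = trans
    (linear-head (c zero) 1ℤ λ u → trans (z≗ u) (cong (c zero * x zero u +_) (sym (ℤ.*-identityˡ _))))
    (cong (c zero * f (x zero ◂ X) +_) (trans (ℤ.*-identityˡ _)
      (linear-head-sum (c ∘ suc) (x ∘ suc) λ _ → refl)))

-- Polarisation: put `x + y` in both of the first two rows and expand. The two terms with a repeated
-- row vanish.
alternating-swap : ∀ {n m} {f : Form (suc (suc n)) m} → Alternating f →
  ∀ x y X → f (x ◂ y ◂ X) ≡ - f (y ◂ x ◂ X)
alternating-swap {f = f} alt x y X = cancel (f (x ◂ y ◂ X)) (f (y ◂ x ◂ X)) (begin
  0ℤ                                       ≡⟨ adjacent alt {zero} {suc zero} refl (λ _ → refl) ⟨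
  f (s ◂ s ◂ X)                            ≡⟨ linear-head alt 1ℤ 1ℤ split ⟩
  1ℤ * f (x ◂ s ◂ X) + 1ℤ * f (y ◂ s ◂ X)  ≡⟨ cong₂ (λ a b → 1ℤ * a + 1ℤ * b)
                                                (linear-head (alternating-◂ alt x) 1ℤ 1ℤ split)
                                                (linear-head (alternating-◂ alt y) 1ℤ 1ℤ split) ⟩
  1ℤ * (1ℤ * f (x ◂ x ◂ X) + 1ℤ * f (x ◂ y ◂ X)) + 1ℤ * (1ℤ * f (y ◂ x ◂ X) + 1ℤ * f (y ◂ y ◂ X))
    ≡⟨ cong₂ (λ a b → 1ℤ * (1ℤ * a + 1ℤ * f (x ◂ y ◂ X)) + 1ℤ * (1ℤ * f (y ◂ x ◂ X) + 1ℤ * b))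
         (repeated x) (repeated y) ⟩
  1ℤ * (1ℤ * 0ℤ + 1ℤ * f (x ◂ y ◂ X)) + 1ℤ * (1ℤ * f (y ◂ x ◂ X) + 1ℤ * 0ℤ) ∎)
  where
  s = λ u → x u + y u

  split : ∀ u → s u ≡ 1ℤ * x u + 1ℤ * y u
  split u = sym (cong₂ _+_ (ℤ.*-identityˡ (x u)) (ℤ.*-identityˡ (y u)))

  repeated : ∀ z → f (z ◂ z ◂ X) ≡ 0ℤ
  repeated z = adjacent alt {zero} {suc zero} refl (λ _ → refl)

  cancel : ∀ a b → 0ℤ ≡ 1ℤ * (1ℤ * 0ℤ + 1ℤ * a) + 1ℤ * (1ℤ * b + 1ℤ * 0ℤ) → a ≡ - b
  cancel a b eq = trans (rearranged a b) (trans (cong (_- b) (sym eq)) (ℤ.+-identityˡ (- b)))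
    where
    rearranged : ∀ a b → a ≡ 1ℤ * (1ℤ * 0ℤ + 1ℤ * a) + 1ℤ * (1ℤ * b + 1ℤ * 0ℤ) - b
    rearranged = solve-∀

-- Row `j` reaches the top by `toℕ j` adjacent swaps, each of which changes the sign.
alternating-cycle : ∀ {n m} {f : Form (suc n) m} → Alternating f →
  ∀ j X → f (X j ◂ (X ∘ punchIn j)) ≡ -1ℤ ^ toℕ j * f X
alternating-cycle alt zero X =
  trans (f-cong alt λ { zero u → refl ; (suc k) u → refl }) (sym (ℤ.*-identityˡ _))
alternating-cycle {suc n} {f = f} alt (suc j) X = begin
  f (X (suc j) ◂ (X ∘ punchIn (suc j)))
    ≡⟨ f-cong alt (λ { zero u → refl ; (suc zero) u → refl ; (suc (suc k)) u → refl }) ⟩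
  f (X (suc j) ◂ X zero ◂ (tail X ∘ punchIn j))
    ≡⟨ alternating-swap alt (X (suc j)) (X zero) _ ⟩
  - f (X zero ◂ X (suc j) ◂ (tail X ∘ punchIn j))
    ≡⟨ cong -_ (alternating-cycle (alternating-◂ alt (X zero)) j (tail X)) ⟩
  - (-1ℤ ^ toℕ j * f (X zero ◂ tail X))
    ≡⟨ cong (λ y → - (-1ℤ ^ toℕ j * y)) (f-cong alt λ { zero u → refl ; (suc k) u → refl }) ⟩
  - (-1ℤ ^ toℕ j * f X)
    ≡⟨ negate (-1ℤ ^ toℕ j) (f X) ⟩
  -1ℤ ^ toℕ (suc j) * f X ∎
  where
  negate : ∀ s x → - (s * x) ≡ -1ℤ * s * x
  negate = solve-∀

sign-square : ∀ k → -1ℤ ^ k * -1ℤ ^ k ≡ 1ℤ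
sign-square zero    = refl
sign-square (suc k) = trans (square (-1ℤ ^ k)) (sign-square k)
  where
  square : ∀ s → -1ℤ * s * (-1ℤ * s) ≡ s * s
  square = solve-∀

sign-cancel : ∀ k x → -1ℤ ^ k * (-1ℤ ^ k * x) ≡ x
sign-cancel k x = trans (sym (ℤ.*-assoc (-1ℤ ^ k) (-1ℤ ^ k) x))
  (trans (cong (_* x) (sign-square k)) (ℤ.*-identityˡ x))

alternating-repeat : ∀ {n m} {f : Form (suc n) m} → Alternating f →
  ∀ {x X} j → X j ≗ x → f (x ◂ X) ≡ 0ℤ
alternating-repeat {suc n} {f = f} alt {x} {X} j Xj≗x = begin
  f (x ◂ X)
    ≡⟨ sign-cancel (toℕ j) _ ⟨
  -1ℤ ^ toℕ j * (-1ℤ ^ toℕ j * f (x ◂ X))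
    ≡⟨ cong (-1ℤ ^ toℕ j *_) (alternating-cycle (alternating-◂ alt x) j X) ⟨
  -1ℤ ^ toℕ j * f (x ◂ X j ◂ (X ∘ punchIn j))
    ≡⟨ cong (-1ℤ ^ toℕ j *_) (adjacent alt {zero} {suc zero} refl (sym ∘ Xj≗x)) ⟩
  -1ℤ ^ toℕ j * 0ℤ
    ≡⟨ ℤ.*-zeroʳ (-1ℤ ^ toℕ j) ⟩
  0ℤ ∎

-- The rows are shifted one at a time, and `vanish` kills the extra term. Taking `vanish` as a
-- hypothesis lets the induction absorb the rows already treated into the form.
alternating-shift : ∀ {n m} {f : Form n m} → Alternating f →
  ∀ w → (∀ X i → X i ≗ w → f X ≡ 0ℤ) →
  ∀ (c : Vector ℤ n) {X Y} → (∀ i u → X i u ≡ Y i u + c i * w u) → f X ≡ f Y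
alternating-shift {zero}  alt w vanish c X≐ = f-cong alt λ ()
alternating-shift {suc n} {f = f} alt w vanish c {X} {Y} X≐ = begin
  f X
    ≡⟨ f-cong alt (λ { zero u → refl ; (suc i) u → refl }) ⟩
  f (X zero ◂ tail X)
    ≡⟨ linear-head alt 1ℤ (c zero) (λ u → trans (X≐ zero u) (cong (_+ c zero * w u) (sym (ℤ.*-identityˡ (Y zero u))))) ⟩
  1ℤ * f (Y zero ◂ tail X) + c zero * f (w ◂ tail X)
    ≡⟨ cong (λ y → 1ℤ * f (Y zero ◂ tail X) + c zero * y) (vanish (w ◂ tail X) zero λ _ → refl) ⟩
  1ℤ * f (Y zero ◂ tail X) + c zero * 0ℤ
    ≡⟨ simplify (f (Y zero ◂ tail X)) (c zero) ⟩
  f (Y zero ◂ tail X)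
    ≡⟨ alternating-shift (alternating-◂ alt (Y zero)) w (λ Z i → vanish (Y zero ◂ Z) (suc i))
         (c ∘ suc) (X≐ ∘ suc) ⟩
  f (Y zero ◂ tail Y)
    ≡⟨ f-cong alt (λ { zero u → refl ; (suc i) u → refl }) ⟩
  f Y ∎
  where
  simplify : ∀ x c → 1ℤ * x + c * 0ℤ ≡ x
  simplify = solve-∀

-- The identity matrix and uniqueness of alternating forms

δ-refl : ∀ {n} (i : Fin n) → δ i i ≡ 1ℤ
δ-refl zero    = refl
δ-refl (suc i) = δ-refl i

δ-≢ : ∀ {n} {i j : Fin n} → i ≢ j → δ i j ≡ 0ℤ
δ-≢ {i = i} {j} i≢j with i ≟ j
... | yes i≡j = contradiction i≡j i≢j
... | no  _   = refl

sum-*-δ : ∀ {n} (f : Vector ℤ n) j → sum (λ i → f i * δ i j) ≡ f j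
sum-*-δ f zero = begin
  f zero * 1ℤ + sum (λ i → f (suc i) * 0ℤ) ≡⟨ cong₂ _+_ (ℤ.*-identityʳ (f zero)) (sum-zero λ i → ℤ.*-zeroʳ (f (suc i))) ⟩
  f zero + 0ℤ                              ≡⟨ ℤ.+-identityʳ (f zero) ⟩
  f zero                                   ∎
sum-*-δ f (suc j) = begin
  f zero * 0ℤ + sum (λ i → f (suc i) * δ i j) ≡⟨ cong₂ _+_ (ℤ.*-zeroʳ (f zero)) (sum-*-δ (f ∘ suc) j) ⟩
  0ℤ + f (suc j)                              ≡⟨ ℤ.+-identityˡ (f (suc j)) ⟩
  f (suc j)                                   ∎

δ-sym : ∀ {n} (i j : Fin n) → δ i j ≡ δ j i
δ-sym zero    zero    = refl
δ-sym zero    (suc j) = refl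
δ-sym (suc i) zero    = refl
δ-sym (suc i) (suc j) = δ-sym i j

sum-δ-* : ∀ {n} (f : Vector ℤ n) j → sum (λ i → δ j i * f i) ≡ f j
sum-δ-* f j = trans
  (sum-cong-≗ λ i → trans (cong (_* f i) (δ-sym j i)) (ℤ.*-comm (δ i j) (f i)))
  (sum-*-δ f j)

·-linear : ∀ {m n} a b (A : Matrix m n) {x y z : Vector ℤ m} → (∀ k → z k ≡ a * x k + b * y k) → ∀ u →
  sum (λ k → z k * A k u) ≡ a * sum (λ k → x k * A k u) + b * sum (λ k → y k * A k u)
·-linear a b A {x} {y} {z} z≗ u = begin
  sum (λ k → z k * A k u)
    ≡⟨ sum-cong-≗ (λ k → trans (cong (_* A k u) (z≗ k)) (distrib a b (x k) (y k) (A k u))) ⟩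
  sum (λ k → a * (x k * A k u) + b * (y k * A k u))
    ≡⟨ ∑-distrib-+ (λ k → a * (x k * A k u)) (λ k → b * (y k * A k u)) ⟩
  sum (λ k → a * (x k * A k u)) + sum (λ k → b * (y k * A k u))
    ≡⟨ cong₂ _+_ (*-distribˡ-sum a (λ k → x k * A k u)) (*-distribˡ-sum b (λ k → y k * A k u)) ⟨
  a * sum (λ k → x k * A k u) + b * sum (λ k → y k * A k u) ∎
  where
  distrib : ∀ a b x y c → (a * x + b * y) * c ≡ a * (x * c) + b * (y * c)
  distrib = solve-∀

-- Row `i` of `X · A` depends only on row `i` of `X`, and linearly, so each axiom transfers.
alternating-· : ∀ {l m n} {f : Form l n} → Alternating f → (A : Matrix m n) → Alternating (λ X → f (X · A))
alternating-· alt A .f-cong X≐Y = f-cong alt λ i u → sum-cong-≗ λ k → cong (_* A k u) (X≐Y i k)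
alternating-· alt A .linear i a b X~Z Y~Z Z≗ = linear alt i a b
  (λ k k≢i u → sum-cong-≗ λ l → cong (_* A l u) (X~Z k k≢i l))
  (λ k k≢i u → sum-cong-≗ λ l → cong (_* A l u) (Y~Z k k≢i l))
  (·-linear a b A Z≗)
alternating-· alt A .adjacent j≡1+i Xi≗Xj = adjacent alt j≡1+i λ u → sum-cong-≗ λ k → cong (_* A k u) (Xi≗Xj k)

-- Expand the first row in the standard basis. Below a first row `δ j`, column `j` can be cleared,
-- which leaves an alternating form in the minor. Induction then turns the sum into the cofactor
-- expansion.
alternating-unique : ∀ {n} {f : Form n n} → Alternating f → ∀ X → f X ≡ det X * f δ
alternating-unique {zero}  alt X = trans (f-cong alt λ ()) (sym (ℤ.*-identityˡ _))
alternating-unique {suc n} {f} alt X = begin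
  f X
    ≡⟨ f-cong alt (λ { zero u → refl ; (suc i) u → refl }) ⟩
  f (X zero ◂ tail X)
    ≡⟨ linear-head-sum alt (X zero) δ (λ u → sym (sum-*-δ (X zero) u)) ⟩
  sum (λ j → X zero j * f (δ j ◂ tail X))
    ≡⟨ sum-cong-≗ (λ j → cong (X zero j *_) (clear j)) ⟩
  sum (λ j → X zero j * f (δ j ◂ minor X zero j · P j))
    ≡⟨ sum-cong-≗ (λ j → cong (X zero j *_)
         (alternating-unique (alternating-· (alternating-◂ alt (δ j)) (P j)) (minor X zero j))) ⟩
  sum (λ j → X zero j * (det (minor X zero j) * f (δ j ◂ δ · P j)))
    ≡⟨ sum-cong-≗ (λ j → cong (λ y → X zero j * (det (minor X zero j) * y)) (cycle j)) ⟩
  sum (λ j → X zero j * (det (minor X zero j) * (-1ℤ ^ toℕ j * f δ)))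
    ≡⟨ sum-cong-≗ (λ j → rearrange (X zero j) (det (minor X zero j)) (-1ℤ ^ toℕ j) (f δ)) ⟩
  sum (λ j → -1ℤ ^ toℕ j * X zero j * det (minor X zero j) * f δ)
    ≡⟨ *-distribʳ-sum (f δ) (λ j → -1ℤ ^ toℕ j * X zero j * det (minor X zero j)) ⟨
  det X * f δ ∎
  where
  -- Right multiplication by `P j` inserts a zero entry at position `j` of every row.
  P : Fin (suc n) → Matrix n (suc n)
  P j l = δ (punchIn j l)

  -- The entries in column j of the other rows may be cleared, as the first row is δ j.
  clear : ∀ j → f (δ j ◂ tail X) ≡ f (δ j ◂ minor X zero j · P j)
  clear j = alternating-shift (alternating-◂ alt (δ j)) (δ j) (λ Y i → alternating-repeat alt {X = Y} i)
    (λ i → X (suc i) j) λ i u → begin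
      X (suc i) u                                        ≡⟨ sum-*-δ (X (suc i)) u ⟨
      sum (λ k → X (suc i) k * δ k u)                    ≡⟨ sum-remove {i = j} (λ k → X (suc i) k * δ k u) ⟩
      X (suc i) j * δ j u + (minor X zero j · P j) i u   ≡⟨ ℤ.+-comm (X (suc i) j * δ j u) _ ⟩
      (minor X zero j · P j) i u + X (suc i) j * δ j u   ∎

  -- This matrix is the identity with row `j` moved to the top.
  cycle : ∀ j → f (δ j ◂ δ · P j) ≡ -1ℤ ^ toℕ j * f δ
  cycle j = trans
    (f-cong alt (◂-cong (λ _ → refl) λ i u → sum-δ-* (λ l → P j l u) i))
    (alternating-cycle alt j δ)

  rearrange : ∀ x d s y → x * (d * (s * y)) ≡ s * x * d * y
  rearrange = solve-∀

-- The determinant as an alternating form, with products and kernels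

-- In the expansion along the first column the first two terms cancel, since their minors agree.
-- Every later minor still has two equal first rows.
det-equal-first-rows : ∀ n (X : Matrix (suc (suc n)) (suc (suc n))) → X zero ≗ X (suc zero) → det X ≡ 0ℤ
det-equal-first-rows n X X₀≗X₁ = begin
  det X
    ≡⟨ det-expand-column X ⟩
  1ℤ * X zero zero * d zero + (-1ℤ * X (suc zero) zero * d (suc zero) + sum (λ i → c (suc (suc i))))
    ≡⟨ cong₂ (λ y z → 1ℤ * X zero zero * d zero + (-1ℤ * X (suc zero) zero * y + z))
         (det-cong {A = minor X (suc zero) zero} {B = minor X zero zero}
           λ { zero l → X₀≗X₁ (suc l) ; (suc k) l → refl })
         (sum-zero {f = λ i → c (suc (suc i))} λ i → trans (cong (-1ℤ ^ toℕ (suc (suc i)) * X (suc (suc i)) zero *_) (rest i))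
                               (ℤ.*-zeroʳ (-1ℤ ^ toℕ (suc (suc i)) * X (suc (suc i)) zero))) ⟩
  1ℤ * X zero zero * d zero + (-1ℤ * X (suc zero) zero * d zero + 0ℤ)
    ≡⟨ cong (λ x → 1ℤ * x * d zero + (-1ℤ * X (suc zero) zero * d zero + 0ℤ)) (X₀≗X₁ zero) ⟩
  1ℤ * X (suc zero) zero * d zero + (-1ℤ * X (suc zero) zero * d zero + 0ℤ)
    ≡⟨ cancel (X (suc zero) zero) (d zero) ⟩
  0ℤ ∎
  where
  c d : Vector ℤ (suc (suc n))
  d i = det (minor X i zero)
  c i = -1ℤ ^ toℕ i * X i zero * d i

  rest : ∀ i → d (suc (suc i)) ≡ 0ℤ
  rest = minor-vanishes n X X₀≗X₁
    where
    -- A third row exists only when `n` is a successor, and then the induction hypothesis applies to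
    -- the minor.
    minor-vanishes : ∀ n (X : Matrix (suc (suc n)) (suc (suc n))) → X zero ≗ X (suc zero) →
      ∀ i → det (minor X (suc (suc i)) zero) ≡ 0ℤ
    minor-vanishes (suc n) X X₀≗X₁ i =
      det-equal-first-rows n (minor X (suc (suc i)) zero) (λ u → X₀≗X₁ (suc u))

  cancel : ∀ x d → 1ℤ * x * d + (-1ℤ * x * d + 0ℤ) ≡ 0ℤ
  cancel = solve-∀
-- The cofactors of the first row do not involve that row, which gives linearity there; for later
-- rows linearity passes through the minors. Equal adjacent rows below the first survive in every
-- minor.
det-alternating : ∀ n → Alternating (det {n})
det-alternating n .f-cong = det-cong
det-alternating (suc n) .linear zero a b {X} {Y} {Z} X~Z Y~Z Z≗ = begin
  det Z
    ≡⟨ sum-cong-≗ (λ j → trans (cong (λ z → s j * z * d j) (Z≗ j)) (distrib a b (s j) (X zero j) (Y zero j) (d j))) ⟩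
  sum (λ j → a * (s j * X zero j * d j) + b * (s j * Y zero j * d j))
    ≡⟨ ∑-distrib-+ (λ j → a * (s j * X zero j * d j)) (λ j → b * (s j * Y zero j * d j)) ⟩
  sum (λ j → a * (s j * X zero j * d j)) + sum (λ j → b * (s j * Y zero j * d j))
    ≡⟨ cong₂ _+_ (*-distribˡ-sum a (λ j → s j * X zero j * d j)) (*-distribˡ-sum b (λ j → s j * Y zero j * d j)) ⟨
  a * sum (λ j → s j * X zero j * d j) + b * sum (λ j → s j * Y zero j * d j)
    ≡⟨ cong₂ (λ x y → a * x + b * y)
         (sum-cong-≗ λ j → cong (s j * X zero j *_) (det-cong λ k l → X~Z (suc k) (λ ()) (punchIn j l)))
         (sum-cong-≗ λ j → cong (s j * Y zero j *_) (det-cong λ k l → Y~Z (suc k) (λ ()) (punchIn j l))) ⟨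
  a * det X + b * det Y ∎
  where
  s d : Vector ℤ (suc n)
  s j = -1ℤ ^ toℕ j
  d j = det (minor Z zero j)

  distrib : ∀ a b s x y d → s * (a * x + b * y) * d ≡ a * (s * x * d) + b * (s * y * d)
  distrib = solve-∀
det-alternating (suc n) .linear (suc i) a b {X} {Y} {Z} X~Z Y~Z Z≗ = begin
  det Z
    ≡⟨ sum-cong-≗ (λ j → cong (s j * Z zero j *_)
         (linear (det-alternating n) i a b {minor X zero j} {minor Y zero j}
           (λ k k≢i u → X~Z (suc k) (k≢i ∘ suc-injective) (punchIn j u))
           (λ k k≢i u → Y~Z (suc k) (k≢i ∘ suc-injective) (punchIn j u))
           (λ u → Z≗ (punchIn j u)))) ⟩
  sum (λ j → s j * Z zero j * (a * det (minor X zero j) + b * det (minor Y zero j)))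
    ≡⟨ sum-cong-≗ (λ j → trans
         (distrib a b (s j) (Z zero j) (det (minor X zero j)) (det (minor Y zero j)))
         (cong₂ (λ x y → a * (s j * x * det (minor X zero j)) + b * (s j * y * det (minor Y zero j)))
           (sym (X~Z zero (λ ()) j)) (sym (Y~Z zero (λ ()) j)))) ⟩
  sum (λ j → a * (s j * X zero j * det (minor X zero j)) + b * (s j * Y zero j * det (minor Y zero j)))
    ≡⟨ ∑-distrib-+ (λ j → a * (s j * X zero j * det (minor X zero j)))
                 (λ j → b * (s j * Y zero j * det (minor Y zero j))) ⟩
  sum (λ j → a * (s j * X zero j * det (minor X zero j))) + sum (λ j → b * (s j * Y zero j * det (minor Y zero j)))
    ≡⟨ cong₂ _+_ (*-distribˡ-sum a (λ j → s j * X zero j * det (minor X zero j)))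
                 (*-distribˡ-sum b (λ j → s j * Y zero j * det (minor Y zero j))) ⟨
  a * det X + b * det Y ∎
  where
  s : Vector ℤ (suc n)
  s j = -1ℤ ^ toℕ j

  distrib : ∀ a b s z x y → s * z * (a * x + b * y) ≡ a * (s * z * x) + b * (s * z * y)
  distrib = solve-∀
det-alternating (suc (suc n)) .adjacent {zero} {suc zero} {X} _ = det-equal-first-rows n X
det-alternating (suc n) .adjacent {suc i} {suc j} {X} j≡1+i Xi≗Xj = sum-zero λ l → trans
  (cong (-1ℤ ^ toℕ l * X zero l *_)
    (adjacent (det-alternating n) {X = minor X zero l} (cong ℕ.pred j≡1+i) (λ u → Xi≗Xj (punchIn l u))))
  (ℤ.*-zeroʳ (-1ℤ ^ toℕ l * X zero l))

-- As a function of `X` the left side is an alternating form whose value at the identity is `det A`.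
det-· : ∀ {n} (X A : Matrix n n) → det (X · A) ≡ det X * det A
det-· {n} X A = trans (alternating-unique (alternating-· (det-alternating n) A) X)
  (cong (det X *_) (det-cong λ i j → sum-δ-* (λ k → A k j) i))

det-δ : ∀ n → det {n} δ ≡ 1ℤ
det-δ zero    = refl
det-δ (suc n) = begin
  1ℤ * det {n} δ + sum {n} (λ j → -1ℤ ^ toℕ (suc j) * 0ℤ * det {n} (minor δ zero (suc j)))
    ≡⟨ cong₂ (λ x y → 1ℤ * x + y) (det-δ n)
         (sum-zero {n} λ j → cong (_* det {n} (minor δ zero (suc j))) (ℤ.*-zeroʳ (-1ℤ ^ toℕ (suc j)))) ⟩
  1ℤ ∎

det-zero-row : ∀ {n} (A : Matrix n n) i → (∀ j → A i j ≡ 0ℤ) → det A ≡ 0ℤ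
det-zero-row {n} A i Ai≡0 = linear (det-alternating n) i 0ℤ 0ℤ {A} {A}
  (λ _ _ _ → refl) (λ _ _ _ → refl) Ai≡0

-- Replace row a of A by the combination z A = 0 of the rows: this
-- multiplies the determinant by z a.
det-left-kernel : ∀ {n} (A : Matrix n n) (z : Vector ℤ n) →
  (∀ j → sum (λ i → z i * A i j) ≡ 0ℤ) → ∀ a → z a * det A ≡ 0ℤ
det-left-kernel {suc n} A z zA≡0 a = begin
  z a * det A
    ≡⟨ cong (z a *_) (sign-cancel (toℕ a) (det A)) ⟨
  z a * (s * (s * det A))
    ≡⟨ commute (z a) s (s * det A) ⟩
  s * (z a * (s * det A))
    ≡⟨ cong (λ x → s * (z a * x)) (alternating-cycle alt a A) ⟨
  s * (z a * d a)
    ≡⟨ cong (s *_) (ℤ.+-identityʳ (z a * d a)) ⟨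
  s * (z a * d a + 0ℤ)
    ≡⟨ cong (λ x → s * (z a * d a + x)) (sum-zero λ k →
         trans (cong (z (punchIn a k) *_) (alternating-repeat alt {X = rows} k λ _ → refl))
               (ℤ.*-zeroʳ (z (punchIn a k)))) ⟨
  s * (z a * d a + sum (λ k → z (punchIn a k) * d (punchIn a k)))
    ≡⟨ cong (s *_) (sum-remove {i = a} (λ k → z k * d k)) ⟨
  s * sum (λ k → z k * d k)
    ≡⟨ cong (s *_) (linear-head-sum alt z A {X = rows} (λ u → sym (zA≡0 u))) ⟨
  s * det ((λ _ → 0ℤ) ◂ rows)
    ≡⟨ cong (s *_) (det-zero-row ((λ _ → 0ℤ) ◂ rows) zero λ _ → refl) ⟩
  s * 0ℤ
    ≡⟨ ℤ.*-zeroʳ s ⟩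
  0ℤ ∎
  where
  alt  = det-alternating (suc n)
  s    = -1ℤ ^ toℕ a
  rows = A ∘ punchIn a
  d : Vector ℤ (suc n)
  d k  = det (A k ◂ rows)

  commute : ∀ x y z → x * (y * z) ≡ y * (x * z)
  commute = solve-∀

det-right-kernel : ∀ {n} (A : Matrix n n) (y : Vector ℤ n) →
  (∀ i → sum (λ j → A i j * y j) ≡ 0ℤ) → ∀ j → y j * det A ≡ 0ℤ
det-right-kernel A y Ay≡0 j = trans (cong (y j *_) (sym (det-transpose A)))
  (det-left-kernel (transpose A) y
    (λ i → trans (sum-cong-≗ λ k → ℤ.*-comm (y k) (A i k)) (Ay≡0 i)) j)

∣i∣≡1⇒i≡±1 : ∀ i → ℤ.∣ i ∣ ≡ 1 → i ≡ 1ℤ ⊎ i ≡ -1ℤ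
∣i∣≡1⇒i≡±1 +[1+ 0 ] refl = inj₁ refl
∣i∣≡1⇒i≡±1 -[1+ 0 ] refl = inj₂ refl

-- Both determinants are integers with product one, so their absolute values are one.
det-right-invertible : ∀ {n} (A X : Matrix n n) → A · X ≐ δ → det A ≡ 1ℤ ⊎ det A ≡ -1ℤ
det-right-invertible {n} A X AX≐δ = ∣i∣≡1⇒i≡±1 (det A)
  (ℕ.m*n≡1⇒m≡1 ℤ.∣ det A ∣ ℤ.∣ det X ∣ (begin
    ℤ.∣ det A ∣ ℕ.* ℤ.∣ det X ∣ ≡⟨ ℤ.abs-* (det A) (det X) ⟨
    ℤ.∣ det A * det X ∣         ≡⟨ cong ℤ.∣_∣ (trans (sym (det-· A X)) (trans (det-cong AX≐δ) (det-δ n))) ⟩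
    1                           ∎))

-- Laplace expansion of a matrix bordered by unit rows

-- A shuffle encodes a k-element subset of Fin q (the ins positions) together with
-- its t-element complement; with both sizes as indices, deletion needs no casts.
data Shuffle : ℕ → ℕ → ℕ → Set where
  []  : Shuffle 0 0 0
  out : ∀ {t k q} → Shuffle t k q → Shuffle (suc t) k (suc q)
  ins : ∀ {t k q} → Shuffle t k q → Shuffle t (suc k) (suc q)

outer : ∀ {t k q} → Shuffle t k q → Fin t → Fin q
outer (out s) zero    = zero
outer (out s) (suc b) = suc (outer s b)
outer (ins s) b       = suc (outer s b)

inner : ∀ {t k q} → Shuffle t k q → Fin k → Fin q
inner (out s) a       = suc (inner s a)
inner (ins s) zero    = zero
inner (ins s) (suc a) = suc (inner s a)

-- The number of pairs in which an out position precedes an ins position.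
inversions : ∀ {t k q} → Shuffle t k q → ℕ
inversions []              = 0
inversions (out {k = k} s) = k ℕ.+ inversions s
inversions (ins s)         = inversions s

sum-shuffle : ∀ {t k q} (s : Shuffle t k q) (f : Vector ℤ q) →
  sum f ≡ sum (f ∘ outer s) + sum (f ∘ inner s)
sum-shuffle []      f = refl
sum-shuffle (out s) f = trans (cong (f zero +_) (sum-shuffle s (tail f)))
  (sym (ℤ.+-assoc (f zero) (sum (tail f ∘ outer s)) (sum (tail f ∘ inner s))))
sum-shuffle (ins s) f = trans (cong (f zero +_) (sum-shuffle s (tail f)))
  (exchange (f zero) (sum (tail f ∘ outer s)) (sum (tail f ∘ inner s)))
  where
  exchange : ∀ x y z → x + (y + z) ≡ y + (x + z)
  exchange = solve-∀

-- Removing the out position `outer s b` loses one inversion for each ins position after it. Of the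
-- `k` ins positions, `toℕ (outer s b)` minus `toℕ b` lie before it; `inversions-rest` records the
-- count without subtraction.
record Deletion {t k q} (s : Shuffle (suc t) k (suc q)) (b : Fin (suc t)) : Set where
  field
    rest            : Shuffle t k q
    outer-rest      : ∀ i → outer s (punchIn b i) ≡ punchIn (outer s b) (outer rest i)
    inner-rest      : ∀ a → inner s a ≡ punchIn (outer s b) (inner rest a)
    inversions-rest : toℕ (outer s b) ℕ.+ inversions s ≡ toℕ b ℕ.+ k ℕ.+ inversions rest

delete : ∀ {t k q} (s : Shuffle (suc t) k (suc q)) b → Deletion s b
delete (out s) zero = record
  { rest = s ; outer-rest = λ _ → refl ; inner-rest = λ _ → refl ; inversions-rest = refl }
delete {suc t} {k} (out {q = suc q} s) (suc b) = record
  { rest            = out rest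
  ; outer-rest      = λ { zero → refl ; (suc i) → cong suc (outer-rest i) }
  ; inner-rest      = λ a → cong suc (inner-rest a)
  ; inversions-rest = trans (left (toℕ (outer s b)) k (inversions s))
      (trans (cong (λ x → suc (k ℕ.+ x)) inversions-rest) (right (toℕ b) k (inversions rest)))
  }
  where
  open Deletion (delete s b)
  left : ∀ o k w → suc o ℕ.+ (k ℕ.+ w) ≡ suc (k ℕ.+ (o ℕ.+ w))
  left = ℕ-RingSolver.solve-∀
  right : ∀ b k w → suc (k ℕ.+ (b ℕ.+ k ℕ.+ w)) ≡ suc b ℕ.+ k ℕ.+ (k ℕ.+ w)
  right = ℕ-RingSolver.solve-∀
delete {suc t} (out {q = zero} ()) (suc b)
delete {k = suc k} (ins {q = suc q} s) b = record
  { rest            = ins rest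
  ; outer-rest      = λ i → cong suc (outer-rest i)
  ; inner-rest      = λ { zero → refl ; (suc a) → cong suc (inner-rest a) }
  ; inversions-rest = trans (cong suc inversions-rest) (shift (toℕ b) k (inversions rest))
  }
  where
  open Deletion (delete s b)
  shift : ∀ b k w → suc (b ℕ.+ k ℕ.+ w) ≡ b ℕ.+ suc k ℕ.+ w
  shift = ℕ-RingSolver.solve-∀
delete (ins {q = zero} ()) b

inversions-full : ∀ {k q} (s : Shuffle 0 k q) → inversions s ≡ 0
inversions-full []      = refl
inversions-full (ins s) = inversions-full s

toℕ-inner-full : ∀ {k q} (s : Shuffle 0 k q) a → toℕ (inner s a) ≡ toℕ a
toℕ-inner-full (ins s) zero    = refl
toℕ-inner-full (ins s) (suc a) = cong suc (toℕ-inner-full s a)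

δ-punchIn : ∀ {n} i (j k : Fin n) → δ (punchIn i j) (punchIn i k) ≡ δ j k
δ-punchIn zero    j       k       = refl
δ-punchIn (suc i) zero    zero    = refl
δ-punchIn (suc i) zero    (suc k) = refl
δ-punchIn (suc i) (suc j) zero    = refl
δ-punchIn (suc i) (suc j) (suc k) = δ-punchIn i j k

-- Signs are their own inverses, so `w` and `w′` may change sides once the count is read modulo two.
sign-deletion : ∀ {o w b k w′} → o ℕ.+ w ≡ b ℕ.+ k ℕ.+ w′ →
  -1ℤ ^ o * -1ℤ ^ w′ ≡ -1ℤ ^ k * (-1ℤ ^ w * -1ℤ ^ b)
sign-deletion {o} {w} {b} {k} {w′} eq = begin
  σ o * σ w′                              ≡⟨ sign-cancel w (σ o * σ w′) ⟨
  σ w * (σ w * (σ o * σ w′))              ≡⟨ left (σ w) (σ o) (σ w′) ⟩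
  σ w * (σ o * σ w * σ w′)                ≡⟨ cong (λ x → σ w * (x * σ w′)) split ⟩
  σ w * (σ b * σ k * σ w′ * σ w′)         ≡⟨ right (σ w) (σ b) (σ k) (σ w′) ⟩
  σ w′ * (σ w′ * (σ k * (σ w * σ b)))     ≡⟨ sign-cancel w′ (σ k * (σ w * σ b)) ⟩
  σ k * (σ w * σ b)                       ∎
  where
  σ : ℕ → ℤ
  σ n = -1ℤ ^ n
  split : σ o * σ w ≡ σ b * σ k * σ w′
  split = begin
    σ o * σ w              ≡⟨ ℤ.^-distribˡ-+-* -1ℤ o w ⟨
    σ (o ℕ.+ w)            ≡⟨ cong σ eq ⟩
    σ (b ℕ.+ k ℕ.+ w′)     ≡⟨ ℤ.^-distribˡ-+-* -1ℤ (b ℕ.+ k) w′ ⟩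
    σ (b ℕ.+ k) * σ w′     ≡⟨ cong (_* σ w′) (ℤ.^-distribˡ-+-* -1ℤ b k) ⟩
    σ b * σ k * σ w′       ∎
  left : ∀ w o v → w * (w * (o * v)) ≡ w * (o * w * v)
  left = solve-∀
  right : ∀ w b k v → w * (b * k * v * v) ≡ v * (v * (k * (w * b)))
  right = solve-∀

-- The shape of the matrix in `χ̂`, with the subset given by a shuffle so that an induction can
-- delete columns.
bordered : ∀ {t k q} → Shuffle t k q → Matrix t q → t ℕ.+ k ≡ q → Matrix q q
bordered s B eq i = (B ++ λ a j → δ j (inner s a)) (cast (sym eq) i)

-- By induction on `t`, expanding along the first row of `B`. Deleting an ins column turns a unit
-- row into zero; deleting an out column leaves a smaller bordered matrix. Each of the `t` rounds
-- contributes the sign `-1ℤ ^ k`.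
det-bordered : ∀ {t k q} (s : Shuffle t k q) (B : Matrix t q) (eq : t ℕ.+ k ≡ q) →
  det (bordered s B eq) ≡ -1ℤ ^ (t ℕ.* k) * (-1ℤ ^ inversions s * det (λ i j → B i (outer s j)))
det-bordered {zero} {k} s B refl = begin
  det (bordered s B refl)
    -- Without out positions `inner s` preserves values, so the matrix is the identity.
    ≡⟨ det-cong (λ i j → trans (δ-sym j (inner s (cast refl i))) (cong (λ l → δ l j)
         (toℕ-injective (trans (toℕ-inner-full s (cast refl i)) (toℕ-cast refl i))))) ⟩
  det {k} δ
    ≡⟨ det-δ k ⟩
  1ℤ
    ≡⟨ cong (λ w → 1ℤ * (-1ℤ ^ w * 1ℤ)) (inversions-full s) ⟨
  1ℤ * (-1ℤ ^ inversions s * 1ℤ) ∎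
det-bordered {suc t} {k} {suc q} s B eq = begin
  sum c
    ≡⟨ sum-shuffle s c ⟩
  sum (c ∘ outer s) + sum (c ∘ inner s)
    ≡⟨ cong₂ _+_ (sum-cong-≗ outer-term) (sum-zero inner-term) ⟩
  sum (λ b → K * (W * (-1ℤ ^ toℕ b * B₀ b * d b))) + 0ℤ
    ≡⟨ ℤ.+-identityʳ _ ⟩
  sum (λ b → K * (W * (-1ℤ ^ toℕ b * B₀ b * d b)))
    ≡⟨ *-distribˡ-sum K (λ b → W * (-1ℤ ^ toℕ b * B₀ b * d b)) ⟨
  K * sum (λ b → W * (-1ℤ ^ toℕ b * B₀ b * d b))
    ≡⟨ cong (K *_) (*-distribˡ-sum W (λ b → -1ℤ ^ toℕ b * B₀ b * d b)) ⟨
  K * (W * sum (λ b → -1ℤ ^ toℕ b * B₀ b * d b)) ∎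
  where
  M = bordered s B eq
  W = -1ℤ ^ inversions s
  K = -1ℤ ^ (suc t ℕ.* k)

  c : Vector ℤ (suc q)
  c j = -1ℤ ^ toℕ j * M zero j * det (minor M zero j)

  B₀ d : Vector ℤ (suc t)
  B₀ b = B zero (outer s b)
  d b = det (λ i j → B (suc i) (outer s (punchIn b j)))

  eq′ : t ℕ.+ k ≡ q
  eq′ = ℕ.suc-injective eq

  rows : Fin t ⊎ Fin k → Vector ℤ (suc q)
  rows = [ tail B , (λ a j → δ j (inner s a)) ]′

  -- At a successor index `splitAt (suc t)` unfolds to `Sum.map suc id` of `splitAt t`, and cases on
  -- the block finish.
  tail-row : ∀ i j → M (suc i) j ≡ rows (splitAt t (cast (sym eq′) i)) j
  tail-row i j = case (splitAt t (cast (sym eq′) i))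
    where
    case : ∀ x → [ B , (λ a j → δ j (inner s a)) ]′ (Sum.map suc id x) j ≡ rows x j
    case (inj₁ _) = refl
    case (inj₂ _) = refl

  inner-term : ∀ a → c (inner s a) ≡ 0ℤ
  inner-term a = trans
    (cong (-1ℤ ^ toℕ (inner s a) * M zero (inner s a) *_)
      -- This index is the row of the minor that comes from unit row `a`; its only nonzero entry
      -- stood in the deleted column.
      (det-zero-row (minor M zero (inner s a)) (cast eq′ (t ↑ʳ a)) λ l → begin
        M (suc (cast eq′ (t ↑ʳ a))) (punchIn (inner s a) l)
          ≡⟨ tail-row (cast eq′ (t ↑ʳ a)) (punchIn (inner s a) l) ⟩
        rows (splitAt t (cast (sym eq′) (cast eq′ (t ↑ʳ a)))) (punchIn (inner s a) l)
          ≡⟨ cong (λ i → rows (splitAt t i) (punchIn (inner s a) l)) (cast-involutive (sym eq′) eq′ (t ↑ʳ a)) ⟩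
        rows (splitAt t (t ↑ʳ a)) (punchIn (inner s a) l)
          ≡⟨ cong (λ x → rows x (punchIn (inner s a) l)) (splitAt-↑ʳ t k a) ⟩
        δ (punchIn (inner s a) l) (inner s a)
          ≡⟨ δ-≢ (punchInᵢ≢i (inner s a) l) ⟩
        0ℤ ∎))
    (ℤ.*-zeroʳ (-1ℤ ^ toℕ (inner s a) * M zero (inner s a)))

  outer-term : ∀ b → c (outer s b) ≡ K * (W * (-1ℤ ^ toℕ b * B₀ b * d b))
  outer-term b = begin
    O * B₀ b * det (minor M zero (outer s b))
      ≡⟨ cong (O * B₀ b *_) (det-cong minor-bordered) ⟩
    O * B₀ b * det (bordered rest B′ eq′)
      ≡⟨ cong (O * B₀ b *_) (det-bordered rest B′ eq′) ⟩
    O * B₀ b * (T * (W′ * det (λ i j → B′ i (outer rest j))))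
      ≡⟨ cong (λ x → O * B₀ b * (T * (W′ * x))) (det-cong λ i j → cong (B (suc i)) (sym (outer-rest j))) ⟩
    O * B₀ b * (T * (W′ * d b))
      ≡⟨ collect O (B₀ b) T W′ (d b) ⟩
    O * W′ * (T * B₀ b * d b)
      ≡⟨ cong (_* (T * B₀ b * d b))
           (sign-deletion {toℕ (outer s b)} {inversions s} {toℕ b} {k} {inversions rest}
             inversions-rest) ⟩
    -1ℤ ^ k * (W * -1ℤ ^ toℕ b) * (T * B₀ b * d b)
      ≡⟨ distribute (-1ℤ ^ k) W (-1ℤ ^ toℕ b) T (B₀ b) (d b) ⟩
    -1ℤ ^ k * T * (W * (-1ℤ ^ toℕ b * B₀ b * d b))
      ≡⟨ cong (_* (W * (-1ℤ ^ toℕ b * B₀ b * d b))) (ℤ.^-distribˡ-+-* -1ℤ k (t ℕ.* k)) ⟨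
    K * (W * (-1ℤ ^ toℕ b * B₀ b * d b)) ∎
    where
    open Deletion (delete s b)
    O  = -1ℤ ^ toℕ (outer s b)
    T  = -1ℤ ^ (t ℕ.* k)
    W′ = -1ℤ ^ inversions rest

    B′ : Matrix t q
    B′ i l = B (suc i) (punchIn (outer s b) l)

    minor-bordered : minor M zero (outer s b) ≐ bordered rest B′ eq′
    minor-bordered i l = trans (tail-row i (punchIn (outer s b) l)) (case (splitAt t (cast (sym eq′) i)))
      where
      case : ∀ x → rows x (punchIn (outer s b) l) ≡ [ B′ , (λ a j → δ j (inner rest a)) ]′ x l
      case (inj₁ i) = refl
      case (inj₂ a) = trans (cong (δ (punchIn (outer s b) l)) (inner-rest a))
                            (δ-punchIn (outer s b) l (inner rest a))

    collect : ∀ o x t w d → o * x * (t * (w * d)) ≡ o * w * (t * x * d)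
    collect = solve-∀
    distribute : ∀ k w b t x d → k * (w * b) * (t * x * d) ≡ k * t * (w * (b * x * d))
    distribute = solve-∀

-- Subsets as shuffles, and the orientation sign

shuffle : ∀ {q} (S : Subset q) → Shuffle ∣ ∁ S ∣ ∣ S ∣ q
shuffle []            = []
shuffle (inside  ∷ S) = ins (shuffle S)
shuffle (outside ∷ S) = out (shuffle S)

inner-shuffle : ∀ {q} (S : Subset q) a → inner (shuffle S) a ≡ enum S a
inner-shuffle (inside  ∷ S) zero    = refl
inner-shuffle (inside  ∷ S) (suc a) = cong suc (inner-shuffle S a)
inner-shuffle (outside ∷ S) a       = cong suc (inner-shuffle S a)

outer-shuffle : ∀ {q} (S : Subset q) b → outer (shuffle S) b ≡ enum (∁ S) b
outer-shuffle (inside  ∷ S) b       = cong suc (outer-shuffle S b)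
outer-shuffle (outside ∷ S) zero    = refl
outer-shuffle (outside ∷ S) (suc b) = cong suc (outer-shuffle S b)

module ℕ-Sum = Algebra.Properties.Semiring.Sum ℕ.+-*-semiring

triangular : ℕ → ℕ
triangular zero    = 0
triangular (suc k) = suc k ℕ.+ triangular k

triangular-double : ∀ k → k ℕ.* suc k ≡ triangular k ℕ.* 2
triangular-double zero    = refl
triangular-double (suc k) = begin
  suc k ℕ.* suc (suc k)           ≡⟨ left k ⟩
  k ℕ.* suc k ℕ.+ suc k ℕ.* 2     ≡⟨ cong (ℕ._+ suc k ℕ.* 2) (triangular-double k) ⟩
  triangular k ℕ.* 2 ℕ.+ suc k ℕ.* 2 ≡⟨ right (triangular k) k ⟩
  (suc k ℕ.+ triangular k) ℕ.* 2  ∎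
  where
  left : ∀ k → suc k ℕ.* suc (suc k) ≡ k ℕ.* suc k ℕ.+ suc k ℕ.* 2
  left = ℕ-RingSolver.solve-∀
  right : ∀ t k → t ℕ.* 2 ℕ.+ suc k ℕ.* 2 ≡ (suc k ℕ.+ t) ℕ.* 2
  right = ℕ-RingSolver.solve-∀

sum-suc : ∀ {k} (f : Fin k → ℕ) → ℕ-Sum.sum (λ a → suc (f a)) ≡ k ℕ.+ ℕ-Sum.sum f
sum-suc {zero}  f = refl
sum-suc {suc k} f = cong suc (trans (cong (f zero ℕ.+_) (sum-suc (f ∘ suc))) (exchange (f zero) k _))
  where
  exchange : ∀ x k y → x ℕ.+ (k ℕ.+ y) ≡ k ℕ.+ (x ℕ.+ y)
  exchange = ℕ-RingSolver.solve-∀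

-- A new first position moves all `∣ S ∣` old ones up by one. If it is outside, this increase is the
-- number of new inversions; if inside, it combines with the new position 1 to extend the triangular
-- number.
sum-positions : ∀ {q} (S : Subset q) →
  ℕ-Sum.sum (λ a → suc (toℕ (enum S a))) ≡ inversions (shuffle S) ℕ.+ triangular ∣ S ∣
sum-positions []            = refl
sum-positions (inside  ∷ S) = begin
  suc (ℕ-Sum.sum (λ a → suc (suc (toℕ (enum S a)))))  ≡⟨ cong suc (sum-suc (λ a → suc (toℕ (enum S a)))) ⟩
  suc (k ℕ.+ ℕ-Sum.sum (λ a → suc (toℕ (enum S a))))  ≡⟨ cong (λ x → suc (k ℕ.+ x)) (sum-positions S) ⟩
  suc (k ℕ.+ (inversions (shuffle S) ℕ.+ triangular k)) ≡⟨ exchange k (inversions (shuffle S)) (triangular k) ⟩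
  inversions (shuffle S) ℕ.+ (suc k ℕ.+ triangular k) ∎
  where
  k = ∣ S ∣
  exchange : ∀ x k y → suc (x ℕ.+ (k ℕ.+ y)) ≡ k ℕ.+ (suc x ℕ.+ y)
  exchange = ℕ-RingSolver.solve-∀
sum-positions (outside ∷ S) = trans (sum-suc (λ a → suc (toℕ (enum S a))))
  (trans (cong (∣ S ∣ ℕ.+_) (sum-positions S)) (sym (ℕ.+-assoc ∣ S ∣ _ _)))

-- The number subtracted in `ε` is the triangular number of `sum-positions`, so exactly the
-- inversions remain.
ε-inversions : ∀ {q} (S : Subset q) → ε S ≡ -1ℤ ^ inversions (shuffle S)
ε-inversions S = cong (-1ℤ ^_) (begin
  ℕ-Sum.sum (λ a → suc (toℕ (enum S a))) ∸ k ℕ.* suc k / 2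
    ≡⟨ cong₂ _∸_ (sum-positions S) (trans (cong (_/ 2) (triangular-double k)) (m*n/n≡m (triangular k) 2)) ⟩
  inversions (shuffle S) ℕ.+ triangular k ∸ triangular k
    ≡⟨ ℕ.m+n∸n≡m (inversions (shuffle S)) (triangular k) ⟩
  inversions (shuffle S) ∎)
  where k = ∣ S ∣

-- The exponents differ by `k ℕ.* suc k`, which is even.
sign-reduce : ∀ t k → -1ℤ ^ (t ℕ.* k) ≡ -1ℤ ^ (k ℕ.* suc (t ℕ.+ k))
sign-reduce t k = sym (begin
  -1ℤ ^ (k ℕ.* suc (t ℕ.+ k))             ≡⟨ cong (-1ℤ ^_) (expand t k) ⟩
  -1ℤ ^ (t ℕ.* k ℕ.+ k ℕ.* suc k)         ≡⟨ ℤ.^-distribˡ-+-* -1ℤ (t ℕ.* k) (k ℕ.* suc k) ⟩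
  -1ℤ ^ (t ℕ.* k) * -1ℤ ^ (k ℕ.* suc k)   ≡⟨ cong (-1ℤ ^ (t ℕ.* k) *_) even ⟩
  -1ℤ ^ (t ℕ.* k) * 1ℤ                    ≡⟨ ℤ.*-identityʳ _ ⟩
  -1ℤ ^ (t ℕ.* k)                         ∎)
  where
  expand : ∀ t k → k ℕ.* suc (t ℕ.+ k) ≡ t ℕ.* k ℕ.+ k ℕ.* suc k
  expand = ℕ-RingSolver.solve-∀

  even : -1ℤ ^ (k ℕ.* suc k) ≡ 1ℤ
  even = begin
    -1ℤ ^ (k ℕ.* suc k)                       ≡⟨ cong (-1ℤ ^_) (trans (triangular-double k) (twice (triangular k))) ⟩
    -1ℤ ^ (triangular k ℕ.+ triangular k)     ≡⟨ ℤ.^-distribˡ-+-* -1ℤ (triangular k) (triangular k) ⟩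
    -1ℤ ^ triangular k * -1ℤ ^ triangular k   ≡⟨ sign-square (triangular k) ⟩
    1ℤ                                        ∎
    where
    twice : ∀ t → t ℕ.* 2 ≡ t ℕ.+ t
    twice = ℕ-RingSolver.solve-∀

-- Units and auxiliary sums

unit-cancel : ∀ {y d} → y ≡ 1ℤ ⊎ y ≡ -1ℤ → y * d ≡ 0ℤ → d ≡ 0ℤ
unit-cancel {d = d} (inj₁ refl) d≡0  = trans (sym (ℤ.*-identityˡ d)) d≡0
unit-cancel {d = d} (inj₂ refl) -d≡0 = ℤ.neg-injective (trans (sym (ℤ.-1*i≡-i d)) -d≡0)

sign-values : ∀ k → -1ℤ ^ k ≡ 1ℤ ⊎ -1ℤ ^ k ≡ -1ℤ
sign-values zero    = inj₁ refl
sign-values (suc k) with sign-values k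
... | inj₁ ≡1  = inj₂ (cong (-1ℤ *_) ≡1)
... | inj₂ ≡-1 = inj₁ (cong (-1ℤ *_) ≡-1)

-- The omitted term carries the factor `φ g`. This is how a grounded vertex drops out of a sum over
-- all vertices.
sum-punchIn-δ : ∀ {n} (g : Fin (suc n)) (φ : Vector ℤ (suc n)) → φ g ≡ 0ℤ → ∀ w →
  sum (λ u → φ (punchIn g u) * δ (punchIn g u) w) ≡ φ w
sum-punchIn-δ g φ φg≡0 w = sym (begin
  φ w                                       ≡⟨ sum-*-δ φ w ⟨
  sum (λ u → φ u * δ u w)                   ≡⟨ sum-remove {i = g} (λ u → φ u * δ u w) ⟩
  φ g * δ g w + rest                        ≡⟨ cong (λ x → x * δ g w + rest) φg≡0 ⟩
  0ℤ * δ g w + rest                         ≡⟨ ℤ.+-identityˡ rest ⟩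
  rest                                      ∎)
  where rest = sum (λ u → φ (punchIn g u) * δ (punchIn g u) w)

sum-distribˡ-minus : ∀ {n} (f g h : Vector ℤ n) →
  sum (λ i → f i * (g i - h i)) ≡ sum (λ i → f i * g i) - sum (λ i → f i * h i)
sum-distribˡ-minus f g h = begin
  sum (λ i → f i * (g i - h i))
    ≡⟨ sum-cong-≗ (λ i → expand (f i) (g i) (h i)) ⟩
  sum (λ i → f i * g i + -1ℤ * (f i * h i))
    ≡⟨ ∑-distrib-+ (λ i → f i * g i) (λ i → -1ℤ * (f i * h i)) ⟩
  sum (λ i → f i * g i) + sum (λ i → -1ℤ * (f i * h i))
    ≡⟨ cong (sum (λ i → f i * g i) +_) (trans (sym (*-distribˡ-sum -1ℤ (λ i → f i * h i))) (ℤ.-1*i≡-i _)) ⟩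
  sum (λ i → f i * g i) - sum (λ i → f i * h i) ∎
  where
  expand : ∀ x y z → x * (y - z) ≡ x * y + -1ℤ * (x * z)
  expand = solve-∀

-- Reduced incidence matrices

incidence : ∀ {t e} → Graph (suc t) e → Matrix t e
incidence H a j = δ (Graph.tgt H j) (suc a) - δ (Graph.src H j) (suc a)

module _ {v e} {H : Graph v e} where
  open Graph H

  -- The net number of times the walk traverses each edge along its orientation.
  flow : ∀ {S u w} → Walk S u w → Vector ℤ e
  flow []                      j = 0ℤ
  flow (step i _ (inj₁ _) p) j = flow p j + δ i j
  flow (step i _ (inj₂ _) p) j = flow p j - δ i j

  flow-∉ : ∀ {S u w} (p : Walk S u w) {i} → i ∉ S → flow p i ≡ 0ℤ
  flow-∉ []                          i∉S = refl
  flow-∉ (step j j∈S (inj₁ _) p) {i} i∉S =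
    cong₂ _+_ (flow-∉ p i∉S) (δ-≢ {i = j} {i} λ { refl → i∉S j∈S })
  flow-∉ (step j j∈S (inj₂ _) p) {i} i∉S =
    cong₂ _-_ (flow-∉ p i∉S) (δ-≢ {i = j} {i} λ { refl → i∉S j∈S })

  flow-unused : ∀ {S u w} (p : Walk S u w) {i} → All (i ≢_) (edges p) → flow p i ≡ 0ℤ
  flow-unused []                        _            = refl
  flow-unused (step j _ (inj₁ _) p) {i} (i≢j ∷ i∉p) =
    cong₂ _+_ (flow-unused p i∉p) (δ-≢ {i = j} {i} (i≢j ∘ sym))
  flow-unused (step j _ (inj₂ _) p) {i} (i≢j ∷ i∉p) =
    cong₂ _-_ (flow-unused p i∉p) (δ-≢ {i = j} {i} (i≢j ∘ sym))

  -- Provides the unit coefficient in the linear dependency that a cycle yields.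
  flow-first : ∀ {S u w z i} (i∈S : i ∈ S) (uw : Joins i u w) (p : Walk S w z) → All (i ≢_) (edges p) →
    flow (step i i∈S uw p) i ≡ 1ℤ ⊎ flow (step i i∈S uw p) i ≡ -1ℤ
  flow-first {i = i} i∈S (inj₁ _) p i∉p = inj₁ (cong₂ _+_ (flow-unused p i∉p) (δ-refl i))
  flow-first {i = i} i∈S (inj₂ _) p i∉p = inj₂ (cong₂ _-_ (flow-unused p i∉p) (δ-refl i))

  infixr 5 _◅◅_
  _◅◅_ : ∀ {S u w z} → Walk S u w → Walk S w z → Walk S u z
  []               ◅◅ p′ = p′
  step i i∈S uw p  ◅◅ p′ = step i i∈S uw (p ◅◅ p′)

module _ {t e} {H : Graph (suc t) e} where
  open Graph H

  sum-incidence-δ : ∀ a i → sum (λ j → incidence H a j * δ i j) ≡ incidence H a i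
  sum-incidence-δ a i = trans
    (sum-cong-≗ λ j → cong (incidence H a j *_) (δ-sym i j)) (sum-*-δ (incidence H a) i)

  -- An edge contributes its target minus its source, or the negative when traversed backwards, so
  -- the sum along the walk telescopes.
  flow-boundary : ∀ {S u w} (p : Walk S u w) a →
    sum (λ j → incidence H a j * flow p j) ≡ δ w (suc a) - δ u (suc a)
  flow-boundary {u = u} [] a = trans
    (sum-zero {e} λ j → ℤ.*-zeroʳ (incidence H a j))
    (sym (ℤ.+-inverseʳ (δ u (suc a))))
  flow-boundary {w = w} (step i _ (inj₁ (refl , refl)) p) a = begin
    sum (λ j → incidence H a j * (flow p j + δ i j))
      ≡⟨ sum-cong-≗ (λ j → ℤ.*-distribˡ-+ (incidence H a j) (flow p j) (δ i j)) ⟩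
    sum (λ j → incidence H a j * flow p j + incidence H a j * δ i j)
      ≡⟨ ∑-distrib-+ (λ j → incidence H a j * flow p j) (λ j → incidence H a j * δ i j) ⟩
    sum (λ j → incidence H a j * flow p j) + sum (λ j → incidence H a j * δ i j)
      ≡⟨ cong₂ _+_ (flow-boundary p a) (sum-incidence-δ a i) ⟩
    δ w (suc a) - δ (tgt i) (suc a) + (δ (tgt i) (suc a) - δ (src i) (suc a))
      ≡⟨ telescope (δ w (suc a)) (δ (tgt i) (suc a)) (δ (src i) (suc a)) ⟩
    δ w (suc a) - δ (src i) (suc a) ∎
    where
    telescope : ∀ x y z → x - y + (y - z) ≡ x - z
    telescope = solve-∀
  flow-boundary {w = w} (step i _ (inj₂ (refl , refl)) p) a = begin
    sum (λ j → incidence H a j * (flow p j - δ i j))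
      ≡⟨ sum-distribˡ-minus (incidence H a) (flow p) (δ i) ⟩
    sum (λ j → incidence H a j * flow p j) - sum (λ j → incidence H a j * δ i j)
      ≡⟨ cong₂ _-_ (flow-boundary p a) (sum-incidence-δ a i) ⟩
    δ w (suc a) - δ (src i) (suc a) - (δ (tgt i) (suc a) - δ (src i) (suc a))
      ≡⟨ telescope (δ w (suc a)) (δ (src i) (suc a)) (δ (tgt i) (suc a)) ⟩
    δ w (suc a) - δ (tgt i) (suc a) ∎
    where
    telescope : ∀ x y z → x - y - (z - y) ≡ x - z
    telescope = solve-∀

-- A decision procedure for walks: edges are added one at a time, merging the
-- labels of their end points.
record Labelling {v e} (H : Graph v e) (S : Subset e) : Set where
  open Graph H
  field
    label    : Fin v → Fin v
    constant : ∀ i → i ∈ S → label (src i) ≡ label (tgt i)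
    walk     : ∀ u w → label u ≡ label w → Walk S u w

tail-graph : ∀ {v e} → Graph v (suc e) → Graph v e
tail-graph H = record { src = Graph.src H ∘ suc ; tgt = Graph.tgt H ∘ suc }

lift-walk : ∀ {v e} {H : Graph v (suc e)} {s S u w} →
  Graph.Walk (tail-graph H) S u w → Graph.Walk H (s ∷ S) u w
lift-walk Graph.[]                  = Graph.[]
lift-walk (Graph.step i i∈S uw p) = Graph.step (suc i) (there i∈S) uw (lift-walk p)

labelling : ∀ {v e} (H : Graph v e) (S : Subset e) → Labelling H S
labelling H [] = record
  { label = λ u → u ; constant = λ () ; walk = λ { u .u refl → Graph.[] } }
labelling H (outside ∷ S) = record
  { label    = label
  ; constant = λ { (suc i) (there i∈S) → constant i i∈S }
  ; walk     = λ u w eq → lift-walk (walk u w eq)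
  }
  where open Labelling (labelling (tail-graph H) S)
labelling {v} H (inside ∷ S) = record
  { label    = merge ∘ label
  ; constant = λ { zero here → trans merge-src (sym merge-tgt)
                 ; (suc i) (there i∈S) → cong merge (constant i i∈S) }
  ; walk     = merged-walk
  }
  where
  open Graph H
  open Labelling (labelling (tail-graph H) S)

  s₀ = src zero
  t₀ = tgt zero

  merge : Fin v → Fin v
  merge a with a ≟ label s₀
  ... | yes _ = label t₀
  ... | no  _ = a

  merge-src : merge (label s₀) ≡ label t₀
  merge-src with label s₀ ≟ label s₀
  ... | yes _ = refl
  ... | no ≢  = contradiction refl ≢

  merge-tgt : merge (label t₀) ≡ label t₀
  merge-tgt with label t₀ ≟ label s₀
  ... | yes _ = refl
  ... | no  _ = refl

  old-walk : ∀ u w → label u ≡ label w → Walk (inside ∷ S) u w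
  old-walk u w eq = lift-walk (walk u w eq)

  merged-walk : ∀ u w → merge (label u) ≡ merge (label w) → Walk (inside ∷ S) u w
  merged-walk u w eq with label u ≟ label s₀ | label w ≟ label s₀
  ... | yes u~s | yes w~s = old-walk u w (trans u~s (sym w~s))
  -- Here `merge` has replaced the label of `u` by that of `t₀`, so `w` lies in the old class of
  -- `t₀` and the new edge bridges the two classes.
  ... | yes u~s | no  _   = old-walk u s₀ u~s ◅◅ step zero here (inj₁ (refl , refl)) (old-walk t₀ w eq)
  ... | no  _   | yes w~s = old-walk u t₀ eq ◅◅ step zero here (inj₂ (refl , refl)) (old-walk s₀ w (sym w~s))
  ... | no  _   | no  _   = old-walk u w eq

-- The incidence minor on the complement of `I`

inner∈ : ∀ {q} (I : Subset q) a → inner (shuffle I) a ∈ I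
inner∈ (inside  ∷ I) zero    = here
inner∈ (inside  ∷ I) (suc a) = there (inner∈ I a)
inner∈ (outside ∷ I) a       = there (inner∈ I a)

outer∈ : ∀ {q} (I : Subset q) b → outer (shuffle I) b ∈ ∁ I
outer∈ (inside  ∷ I) b       = there (outer∈ I b)
outer∈ (outside ∷ I) zero    = here
outer∈ (outside ∷ I) (suc b) = there (outer∈ I b)

outer-surjective : ∀ {q} (I : Subset q) {i} → i ∈ ∁ I → ∃[ b ] outer (shuffle I) b ≡ i
outer-surjective (outside ∷ I) here = zero , refl
outer-surjective (outside ∷ I) (there i∈) with outer-surjective I i∈
... | b , refl = suc b , refl
outer-surjective (inside  ∷ I) (there i∈) with outer-surjective I i∈
... | b , refl = b , refl

module _ {q} (I : Subset q) (H : Graph (suc ∣ ∁ I ∣) q) where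
  open Graph H

  private
    s = shuffle I

  -- Giving `H` exactly one vertex more than `∁ I` has edges makes this minor square without casts.
  reduced-incidence : Matrix ∣ ∁ I ∣ ∣ ∁ I ∣
  reduced-incidence a b = incidence H a (outer s b)

  -- The walk stays in `∁ I`, so its flow vanishes on the columns left out.
  reduced-boundary : ∀ {u w} (p : Walk (∁ I) u w) a →
    sum (λ b → reduced-incidence a b * flow p (outer s b)) ≡ δ w (suc a) - δ u (suc a)
  reduced-boundary {u} {w} p a = begin
    sum (f ∘ outer s)                          ≡⟨ ℤ.+-identityʳ _ ⟨
    sum (f ∘ outer s) + 0ℤ                     ≡⟨ cong (sum (f ∘ outer s) +_) (sum-zero inner-term) ⟨
    sum (f ∘ outer s) + sum (f ∘ inner s)      ≡⟨ sum-shuffle s f ⟨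
    sum f                                      ≡⟨ flow-boundary p a ⟩
    δ w (suc a) - δ u (suc a)                  ∎
    where
    f : Vector ℤ q
    f j = incidence H a j * flow p j

    inner-term : ∀ c → f (inner s c) ≡ 0ℤ
    inner-term c = trans
      (cong (incidence H a (inner s c) *_) (flow-∉ p (x∈p⇒x∉∁p (inner∈ I c))))
      (ℤ.*-zeroʳ (incidence H a (inner s c)))

  connected⇒det≡±1 : Connected (∁ I) → det reduced-incidence ≡ 1ℤ ⊎ det reduced-incidence ≡ -1ℤ
  connected⇒det≡±1 connected = det-right-invertible reduced-incidence
    -- Column `a` is the flow of a walk from vertex zero to `suc a`. Vertex zero has no row, so the
    -- start adds nothing to the boundary.
    (λ b a → flow (connected zero (suc a)) (outer s b))
    λ b a → trans (reduced-boundary (connected zero (suc a)) b)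
                  (trans (ℤ.+-identityʳ (δ a b)) (δ-sym a b))

  -- The flow of a closed walk has zero boundary and so lies in the right kernel. The first edge of
  -- a cycle does not recur, so its coordinate is a unit and the determinant would vanish.
  det≢0⇒acyclic : det reduced-incidence ≢ 0ℤ → Acyclic (∁ I)
  det≢0⇒acyclic det≢0 []                              (nonempty , _) = nonempty refl
  det≢0⇒acyclic det≢0 {u} p@(step i i∈∁I uw p′) (_ , i∉p′ ∷ _ , _) with outer-surjective I i∈∁I
  ... | b , refl = det≢0 (unit-cancel (flow-first i∈∁I uw p′ i∉p′)
    (det-right-kernel reduced-incidence (flow p ∘ outer s)
      (λ a → trans (reduced-boundary p a) (ℤ.+-inverseʳ (δ u (suc a)))) b))

  -- The indicator `φ` of the component of `suc a` is zero at vertex zero and takes equal values at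
  -- the ends of every edge of `∁ I`. It is therefore a left kernel vector, with coordinate one at
  -- `a`.
  distinct-labels⇒det≡0 : (L : Labelling H (∁ I)) → let open Labelling L in
    ∀ a → label (suc a) ≢ label zero → det reduced-incidence ≡ 0ℤ
  distinct-labels⇒det≡0 L a a≁0 = begin
    det reduced-incidence             ≡⟨ ℤ.*-identityˡ _ ⟨
    1ℤ * det reduced-incidence        ≡⟨ cong (_* det reduced-incidence) (δ-refl (label (suc a))) ⟨
    φ (suc a) * det reduced-incidence ≡⟨ det-left-kernel reduced-incidence (φ ∘ suc) kernel a ⟩
    0ℤ                                ∎
    where
    open Labelling L
    φ : Vector ℤ (suc ∣ ∁ I ∣)
    φ u = δ (label u) (label (suc a))

    φ-sum : ∀ w → sum (λ c → φ (suc c) * δ w (suc c)) ≡ φ w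
    φ-sum w = trans (sum-cong-≗ λ c → cong (φ (suc c) *_) (δ-sym w (suc c)))
                    (sum-punchIn-δ zero φ (δ-≢ (a≁0 ∘ sym)) w)

    kernel : ∀ b → sum (λ c → φ (suc c) * reduced-incidence c b) ≡ 0ℤ
    kernel b = trans
      (sum-distribˡ-minus (φ ∘ suc) (λ c → δ (tgt (outer s b)) (suc c)) (λ c → δ (src (outer s b)) (suc c)))
      (ℤ.i≡j⇒i-j≡0 (trans (φ-sum (tgt (outer s b))) (trans
        (cong (λ l → δ l (label (suc a))) (sym (constant (outer s b) (outer∈ I b))))
        (sym (φ-sum (src (outer s b)))))))

  -- Comparing every label with that of vertex zero decides the alternative constructively.
  connected-or-det≡0 : Connected (∁ I) ⊎ det reduced-incidence ≡ 0ℤ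
  connected-or-det≡0 with any? (λ a → ¬? (label (suc a) ≟ label zero))
    where open Labelling (labelling H (∁ I))
  ... | yes (a , a≁0) = inj₂ (distinct-labels⇒det≡0 (labelling H (∁ I)) a a≁0)
  ... | no  ∄a        = inj₁ λ u w → walk u w (trans (label-zero u) (sym (label-zero w)))
    where
    open Labelling (labelling H (∁ I))
    label-zero : ∀ u → label u ≡ label zero
    label-zero zero    = refl
    label-zero (suc a) = decidable-stable (label (suc a) ≟ label zero) λ a≁0 → ∄a (a , a≁0)

  det∈0±1 : det reduced-incidence ≡ 0ℤ ⊎ det reduced-incidence ≡ 1ℤ ⊎ det reduced-incidence ≡ -1ℤ
  det∈0±1 with connected-or-det≡0
  ... | inj₁ connected = inj₂ (connected⇒det≡±1 connected)
  ... | inj₂ det≡0     = inj₁ det≡0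

  det≢0⇔spanning-tree : det reduced-incidence ≢ 0ℤ ⇔ IsSpanningTree (∁ I)
  det≢0⇔spanning-tree = mk⇔ to from
    where
    to : det reduced-incidence ≢ 0ℤ → IsSpanningTree (∁ I)
    to det≢0 with connected-or-det≡0
    ... | inj₁ connected = connected , det≢0⇒acyclic det≢0
    ... | inj₂ det≡0     = contradiction det≡0 det≢0

    from : IsSpanningTree (∁ I) → det reduced-incidence ≢ 0ℤ
    from (connected , _) det≡0 with connected⇒det≡±1 connected
    ... | inj₁ det≡1  = contradiction (trans (sym det≡1) det≡0) λ ()
    ... | inj₂ det≡-1 = contradiction (trans (sym det≡-1) det≡0) λ ()

-- Application to the quotient port graph

module _ {n p q} (P : Superports (suc n) p q) where
  open Superports P
  open Quotient P

  -- Row `a` of `Q` is the indicator `φ` of component `suc a`. Since `g` lies in component zero, `φ`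
  -- vanishes there, so pairing with `e w` gives `φ w` even when `w` is `g`.
  B-incidence : ∀ {t} (C : Fin (suc n) → Fin (suc t)) → C g ≡ zero → B C ≐ incidence (H C)
  B-incidence C Cg≡0 a j = trans
    (sum-distribˡ-minus (λ u → φ (punchIn g u)) (e (x j)) (e (r j)))
    (cong₂ _-_ (sum-punchIn-δ g φ φg≡0 (x j)) (sum-punchIn-δ g φ φg≡0 (r j)))
    where
    φ : Vector ℤ (suc n)
    φ v = δ (C v) (suc a)

    φg≡0 : φ g ≡ 0ℤ
    φg≡0 = cong (λ c → δ c (suc a)) Cg≡0

  χ-reduced-incidence : (I : Subset q) (C : Fin (suc n) → Fin (suc ∣ ∁ I ∣)) → C g ≡ zero →
    χ C (∁ I) refl ≡ det (reduced-incidence I (H C))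
  χ-reduced-incidence I C Cg≡0 = det-cong λ a b → trans
    (B-incidence C Cg≡0 a (enum (∁ I) (cast refl b)))
    (cong (incidence (H C) a) (sym (trans (outer-shuffle I b) (cong (enum (∁ I)) (sym (cast-is-id refl b))))))

  χ̂-χ : (I : Subset q) (C : Fin (suc n) → Fin (suc ∣ ∁ I ∣)) (eq : ∣ ∁ I ∣ ℕ.+ ∣ I ∣ ≡ q) →
    χ̂ C I eq ≡ -1ℤ ^ (∣ I ∣ ℕ.* suc q) * ε I * χ C (∁ I) refl
  χ̂-χ I C eq = begin
    χ̂ C I eq
      ≡⟨ det-cong (λ i j → inner-rows j (splitAt t (cast (sym eq) i))) ⟩
    det (bordered s (B C) eq)
      ≡⟨ det-bordered s (B C) eq ⟩
    -1ℤ ^ (t ℕ.* k) * (-1ℤ ^ inversions s * det (λ i j → B C i (outer s j)))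
      ≡⟨ ℤ.*-assoc (-1ℤ ^ (t ℕ.* k)) (-1ℤ ^ inversions s) _ ⟨
    -1ℤ ^ (t ℕ.* k) * -1ℤ ^ inversions s * det (λ i j → B C i (outer s j))
      ≡⟨ cong₂ _*_ (cong₂ _*_
           (trans (sign-reduce t k) (cong (λ q → -1ℤ ^ (k ℕ.* suc q)) eq))
           (sym (ε-inversions I)))
           (det-cong λ i j → cong (B C i) (trans (outer-shuffle I j) (cong (enum (∁ I)) (sym (cast-is-id refl j))))) ⟩
    -1ℤ ^ (k ℕ.* suc q) * ε I * χ C (∁ I) refl ∎
    where
    s = shuffle I
    t = ∣ ∁ I ∣
    k = ∣ I ∣

    inner-rows : ∀ j (i : Fin t ⊎ Fin k) →
      [ B C , transpose (E I) ]′ i j ≡ [ B C , (λ a j → δ j (inner s a)) ]′ i j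
    inner-rows j (inj₁ i) = refl
    inner-rows j (inj₂ a) = cong (δ j) (sym (inner-shuffle I a))

  -- With `t` a variable, matching on `eq′` identifies it with `∣ ∁ I ∣`, the index of `shuffle I`.
  -- The sign `σ` is a unit, so the properties of the minor `d` carry over to `χ̂`.
  χ̂-characterisation : ∀ {t} (I : Subset q) (C : Fin (suc n) → Fin (suc t)) → C g ≡ zero →
    (eq : t ℕ.+ ∣ I ∣ ≡ q) (eq′ : ∣ ∁ I ∣ ≡ t) →
    (χ̂ C I eq ≡ 0ℤ ⊎ χ̂ C I eq ≡ 1ℤ ⊎ χ̂ C I eq ≡ -1ℤ)
    × (χ̂ C I eq ≢ 0ℤ ⇔ Graph.IsSpanningTree (H C) (∁ I))
    × χ̂ C I eq ≡ -1ℤ ^ (∣ I ∣ ℕ.* suc q) * ε I * χ C (∁ I) eq′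
  χ̂-characterisation I C Cg≡0 eq refl = values , nonzero , χ̂-χ I C eq
    where
    d = det (reduced-incidence I (H C))

    σ : ℤ
    σ = -1ℤ ^ (∣ I ∣ ℕ.* suc q) * ε I

    χ̂≡σd : χ̂ C I eq ≡ σ * d
    χ̂≡σd = trans (χ̂-χ I C eq) (cong (σ *_) (χ-reduced-incidence I C Cg≡0))

    σ≡±1 : σ ≡ 1ℤ ⊎ σ ≡ -1ℤ
    σ≡±1 = subst (λ s → s ≡ 1ℤ ⊎ s ≡ -1ℤ)
      (trans (ℤ.^-distribˡ-+-* -1ℤ (∣ I ∣ ℕ.* suc q) (inversions (shuffle I)))
             (cong (-1ℤ ^ (∣ I ∣ ℕ.* suc q) *_) (sym (ε-inversions I))))
      (sign-values (∣ I ∣ ℕ.* suc q ℕ.+ inversions (shuffle I)))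

    sign-product : ∀ {s d} → s ≡ 1ℤ ⊎ s ≡ -1ℤ → d ≡ 0ℤ ⊎ d ≡ 1ℤ ⊎ d ≡ -1ℤ →
      s * d ≡ 0ℤ ⊎ s * d ≡ 1ℤ ⊎ s * d ≡ -1ℤ
    sign-product (inj₁ refl) (inj₁ refl)        = inj₁ refl
    sign-product (inj₁ refl) (inj₂ (inj₁ refl)) = inj₂ (inj₁ refl)
    sign-product (inj₁ refl) (inj₂ (inj₂ refl)) = inj₂ (inj₂ refl)
    sign-product (inj₂ refl) (inj₁ refl)        = inj₁ refl
    sign-product (inj₂ refl) (inj₂ (inj₁ refl)) = inj₂ (inj₂ refl)
    sign-product (inj₂ refl) (inj₂ (inj₂ refl)) = inj₂ (inj₁ refl)

    values : χ̂ C I eq ≡ 0ℤ ⊎ χ̂ C I eq ≡ 1ℤ ⊎ χ̂ C I eq ≡ -1ℤ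
    values = subst (λ y → y ≡ 0ℤ ⊎ y ≡ 1ℤ ⊎ y ≡ -1ℤ) (sym χ̂≡σd) (sign-product σ≡±1 (det∈0±1 I (H C)))

    d≡0⇒χ̂≡0 : d ≡ 0ℤ → χ̂ C I eq ≡ 0ℤ
    d≡0⇒χ̂≡0 d≡0 = trans χ̂≡σd (trans (cong (σ *_) d≡0) (ℤ.*-zeroʳ σ))

    χ̂≡0⇒d≡0 : χ̂ C I eq ≡ 0ℤ → d ≡ 0ℤ
    χ̂≡0⇒d≡0 χ̂≡0 = unit-cancel σ≡±1 (trans (sym χ̂≡σd) χ̂≡0)

    nonzero : χ̂ C I eq ≢ 0ℤ ⇔ Graph.IsSpanningTree (H C) (∁ I)
    nonzero = mk⇔
      (λ χ̂≢0 → Equivalence.to (det≢0⇔spanning-tree I (H C)) (χ̂≢0 ∘ d≡0⇒χ̂≡0))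
      (λ tree → Equivalence.from (det≢0⇔spanning-tree I (H C)) tree ∘ χ̂≡0⇒d≡0)

lemma3p3 :
  ∀ {n m p q} (G : Graph (suc n) m) → Graph.Simple G → Graph.Connected G ⊤ →
  (P : Superports (suc n) p q) →
  (I : Subset q) →
  let k = ∣ I ∣ in
  (F : Subset m) → Graph._∈𝓕_ G F (suc (q ∸ k)) →
  (C : Fin (suc n) → Fin (suc (q ∸ k))) →
  Graph.IsComponentNumbering G F C → C (Superports.g P) ≡ zero →
  let open Quotient P
      χ̂I = χ̂ C I (m∸n+n≡m (∣p∣≤n I))
  in
  (χ̂I ≡ 0ℤ ⊎ χ̂I ≡ 1ℤ ⊎ χ̂I ≡ -1ℤ)
  × (χ̂I ≢ 0ℤ ⇔ Graph.IsSpanningTree (H C) (∁ I))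
  × χ̂I ≡ -1ℤ ^ (k ℕ.* suc q) * ε I * χ C (∁ I) (∣∁p∣≡n∸∣p∣ I)
lemma3p3 _ _ _ P I _ _ C _ Cg≡0 = χ̂-characterisation P I C Cg≡0 (m∸n+n≡m (∣p∣≤n I)) (∣∁p∣≡n∸∣p∣ I)
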